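{- Let $M$ be one of the groups $\mathbb{Z}_2$, $\mathbb{Z}_3$, $\mathbb{Z}_2^2=\mathbb{Z}_2\times\mathbb{Z}_2$, $\mathbb{Z}_4$. Then every directed graph $G=(V,E)$ has the strong homomorphism property for $M$: for every abelian group $M'$, every mapping $m\colon M\to M'$ (not necessarily a group homomorphism) and every $M$-flow $\varphi\colon E\to M$ on $G$, there exists an $M'$-flow $\varphi'\colon E\to M'$ on $G$ such that $\varphi'(e)\in\mathcal{H}_m(\varphi(e))$ for all $e\in E$.
   Context: Graphs are finite directed graphs; loops and parallel edges are allowed. For an abelian group $M$, an $M$-flow on $G=(V,E)$ is a mapping $\varphi\colon E\to M$ such that at every vertex $v$ the sum of $\varphi$ over edges leaving $v$ minus the sum of $\varphi$ over edges entering $v$ is $0$ (the value $0$ is allowed on edges). For abelian groups $M,M'$, any mapping $m\colon M\to M'$ and $x\in M$, the homomorphic image of $x$ is $\mathcal{H}_m(x):=\{\,m(a+x)-m(a) : a\in M\,\}\subseteq M'$. -}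

module Defs where

open import Algebra.Bundles using (AbelianGroup)
import Algebra.Properties.CommutativeMonoid.Sum as Sum
open import Data.Bool.Base using (if_then_else_)
open import Data.Fin.Base using (Fin; toℕ)
open import Data.Fin.Properties using (_≟_; toℕ-fromℕ<; toℕ-injective; toℕ<n; toℕ≤n)
open import Data.Nat.Base using (ℕ; _+_; _∸_; _%_; _<_; NonZero)
open import Data.Nat.DivMod
  using (_mod_; m%n<n; %-distribˡ-+; m%n%n≡m%n; m<n⇒m%n≡m; n%n≡0)
open import Data.Nat.Properties using (+-assoc; +-comm; m∸n+n≡m)
open import Data.Product.Base using (_,_; _×_; ∃-syntax)
open import Function.Bundles using (Func)
open import Level using (0ℓ; _⊔_; suc)
open import Relation.Binary.PropositionalEquality
open import Relation.Nullary.Decidable.Core using (does)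
open import Relation.Unary using (Pred; _∈_)

record Graph : Set where
  field
    #V #E   : ℕ
    src tgt : Fin #E → Fin #V

  V E : Set
  V = Fin #V
  E = Fin #E

module _ {c ℓ} (M : AbelianGroup c ℓ) (G : Graph) where
  open AbelianGroup M using (Carrier; _≈_; ε; _-_; commutativeMonoid)
  open Sum commutativeMonoid using (sum)
  open Graph G

  -- A loop at v both leaves and enters v.
  outSum inSum : (E → Carrier) → V → Carrier
  outSum φ v = sum λ e → if does (src e ≟ v) then φ e else ε
  inSum  φ v = sum λ e → if does (tgt e ≟ v) then φ e else ε

  IsFlow : (E → Carrier) → Set ℓ
  IsFlow φ = ∀ v → outSum φ v - inSum φ v ≈ ε

module _ {c ℓ c′ ℓ′} (M : AbelianGroup c ℓ) (M′ : AbelianGroup c′ ℓ′) where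
  private
    module M  = AbelianGroup M
    module M′ = AbelianGroup M′

  -- A mapping of setoids; it need not respect the group operations.
  Mapping : Set (c ⊔ ℓ ⊔ c′ ⊔ ℓ′)
  Mapping = Func M.setoid M′.setoid

  ℋ : Mapping → M.Carrier → Pred M′.Carrier (c ⊔ ℓ′)
  ℋ m x y = ∃[ a ] y M′.≈ to (a M.∙ x) M′.- to a
    where open Func m using (to)

-- c′ and ℓ′ are the universe levels of the target groups M′.
StrongHomomorphismProperty :
  ∀ {c ℓ} c′ ℓ′ → Graph → AbelianGroup c ℓ → Set (c ⊔ ℓ ⊔ suc (c′ ⊔ ℓ′))
StrongHomomorphismProperty c′ ℓ′ G M =
  (M′ : AbelianGroup c′ ℓ′) (m : Mapping M M′)
  (φ : E → Carrier M) → IsFlow M G φ →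
  ∃[ φ′ ] IsFlow M′ G φ′ × (∀ e → φ′ e ∈ ℋ M M′ m (φ e))
  where
  open Graph G using (E)
  open AbelianGroup using (Carrier)

module _ (n : ℕ) .{{_ : NonZero n}} where
  private
    infixl 6 _⊕_
    _⊕_ : Fin n → Fin n → Fin n
    a ⊕ b = (toℕ a + toℕ b) mod n

    ⊖_ : Fin n → Fin n
    ⊖ a = (n ∸ toℕ a) mod n

    toℕ-mod : ∀ k → toℕ (k mod n) ≡ k % n
    toℕ-mod k = toℕ-fromℕ< (m%n<n k n)

    %-+ˡ : ∀ j k → (j % n + k) % n ≡ (j + k) % n
    %-+ˡ j k = begin
      (j % n + k) % n          ≡⟨ %-distribˡ-+ (j % n) k n ⟩
      (j % n % n + k % n) % n  ≡⟨ cong (λ i → (i + k % n) % n) (m%n%n≡m%n j n) ⟩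
      (j % n + k % n) % n      ≡⟨ %-distribˡ-+ j k n ⟨
      (j + k) % n              ∎
      where open ≡-Reasoning

    mod-⊕ : ∀ k a → toℕ (k mod n ⊕ a) ≡ (k + toℕ a) % n
    mod-⊕ k a = begin
      toℕ (k mod n ⊕ a)            ≡⟨ toℕ-mod _ ⟩
      (toℕ (k mod n) + toℕ a) % n  ≡⟨ cong (λ i → (i + toℕ a) % n) (toℕ-mod k) ⟩
      (k % n + toℕ a) % n          ≡⟨ %-+ˡ k (toℕ a) ⟩
      (k + toℕ a) % n              ∎
      where open ≡-Reasoning

    ⊕-comm : ∀ a b → a ⊕ b ≡ b ⊕ a
    ⊕-comm a b = cong (_mod n) (+-comm (toℕ a) (toℕ b))

    ⊕-assoc : ∀ a b d → (a ⊕ b) ⊕ d ≡ a ⊕ (b ⊕ d)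
    ⊕-assoc a b d = toℕ-injective (begin
      toℕ ((a ⊕ b) ⊕ d)              ≡⟨ mod-⊕ (toℕ a + toℕ b) d ⟩
      (toℕ a + toℕ b + toℕ d) % n    ≡⟨ cong (_% n) (+-assoc (toℕ a) (toℕ b) (toℕ d)) ⟩
      (toℕ a + (toℕ b + toℕ d)) % n  ≡⟨ cong (_% n) (+-comm (toℕ a) (toℕ b + toℕ d)) ⟩
      (toℕ b + toℕ d + toℕ a) % n    ≡⟨ mod-⊕ (toℕ b + toℕ d) a ⟨
      toℕ ((b ⊕ d) ⊕ a)              ≡⟨ cong toℕ (⊕-comm (b ⊕ d) a) ⟩
      toℕ (a ⊕ (b ⊕ d))              ∎)
      where open ≡-Reasoning

    ⊕-identityˡ : ∀ a → 0 mod n ⊕ a ≡ a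
    ⊕-identityˡ a = toℕ-injective (trans (mod-⊕ 0 a) (m<n⇒m%n≡m (toℕ<n a)))

    ⊕-inverseˡ : ∀ a → ⊖ a ⊕ a ≡ 0 mod n
    ⊕-inverseˡ a = toℕ-injective (begin
      toℕ (⊖ a ⊕ a)            ≡⟨ mod-⊕ (n ∸ toℕ a) a ⟩
      (n ∸ toℕ a + toℕ a) % n  ≡⟨ cong (_% n) (m∸n+n≡m (toℕ≤n a)) ⟩
      n % n                    ≡⟨ n%n≡0 n ⟩
      0                        ≡⟨ m<n⇒m%n≡m (subst (_< n) (n%n≡0 n) (m%n<n n n)) ⟨
      0 % n                    ≡⟨ toℕ-mod 0 ⟨
      toℕ (0 mod n)            ∎)
      where open ≡-Reasoning

  ℤ/ : AbelianGroup 0ℓ 0ℓ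
  ℤ/ = record
    { Carrier = Fin n
    ; _≈_     = _≡_
    ; _∙_     = _⊕_
    ; ε       = 0 mod n
    ; _⁻¹     = ⊖_
    ; isAbelianGroup = record
      { isGroup = record
        { isMonoid = record
          { isSemigroup = record
            { isMagma = record { isEquivalence = isEquivalence ; ∙-cong = cong₂ _⊕_ }
            ; assoc   = ⊕-assoc
            }
          ; identity = ⊕-identityˡ , λ a → trans (⊕-comm a _) (⊕-identityˡ a)
          }
        ; inverse = ⊕-inverseˡ , λ a → trans (⊕-comm a _) (⊕-inverseˡ a)
        ; ⁻¹-cong = cong ⊖_
        }
      ; comm = ⊕-comm
      }
    }

{-# OPTIONS --safe #-}
-- It suffices to treat the universal target ℤᴹ with m = δ: every edge e needs a pair
-- (a , a + φ e) such that the vectors δ (a + φ e) - δ a form a flow.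
-- The only combinatorial tool is Tutte's rounding: an integer chain ψ whose divergence is
-- divisible by q becomes a circulation after each ψ e is replaced by one of the (at most two)
-- integers of absolute value < q congruent to it mod q.  With F ≡ ψ rounded mod q:
--   ℤ/2 :   F ≡ φ (mod 2) already gives the arc F (δ 1 - δ 0);
--   ℤ/3 :   F ≡ φ (mod 3), then D ≡ F (mod 2) orients the edges with F odd;
--   ℤ/2² :  the three nontrivial characters of ℤ/2² see three independent orientations,
--           of the edges on which φ is nontrivial under the character;
--   ℤ/4 :   U ≡ φ (mod 2), then P ≡ (φ + U)/2 and Q ≡ U + P (mod 2) play the same role.
-- In each case a finite computation checks that the resulting coefficients are an arc.
-- Rounding is integral transport of the demands div/q along the edges, by induction on the edges: an
-- edge that cannot be dropped without violating the cut condition leaves a tight cut, and by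
-- submodularity the cut condition survives once that edge is used.
module Submission where

open import Defs
open import Algebra.Bundles using (AbelianGroup; CommutativeMonoid)
import Algebra.Construct.Pointwise as Pointwise
open import Algebra.Construct.DirectProduct using (abelianGroup)
import Algebra.Properties.AbelianGroup as AbelianGroupProperties
import Algebra.Properties.CommutativeMonoid.Sum as Sum
import Algebra.Properties.Monoid.Mult as Mult
import Algebra.Properties.Semiring.Sum as SemiringSum
open import Data.Bool.Base using (Bool; true; false; if_then_else_; not; _∧_; _∨_)
open import Data.Bool.Properties using (∧-identityʳ)
open import Data.Fin.Base using (Fin; zero; suc; toℕ)
open import Data.Fin.Patterns using (0F; 1F; 2F; 3F)
open import Data.Fin.Properties as Fin using (_≟_; toℕ-fromℕ<; toℕ≤n)
open import Data.Fin.Subset.Properties using (anySubset?)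
open import Data.Integer.Base as ℤ using (ℤ; +_; -[1+_]; 0ℤ; 1ℤ; -1ℤ; _⊖_)
open import Data.Integer.DivMod using (_/ℕ_; _%ℕ_; a≡a%ℕn+[a/ℕn]*n; n%ℕd<d)
open import Data.Integer.Divisibility.Signed using (_∣_; divides; quotient; ∣-trans)
import Data.Integer.Properties as ℤ
open import Data.Integer.Tactic.RingSolver using (solve-∀)
open import Data.List.Base using (List; []; _∷_)
open import Data.List.Membership.Propositional using (_∈_)
open import Data.List.Relation.Unary.All as All using (All; all?)
open import Data.List.Relation.Unary.Any using (here; there)
open import Data.Nat.Base as ℕ using (ℕ; nonZero)
open import Data.Nat.DivMod using (_mod_; _/_; _%_; m≡m%n+[m/n]*n; m%n<n)
import Data.Nat.Properties as ℕ
open import Data.Product.Base using (_,_; _×_; ∃; ∃-syntax; proj₁; proj₂)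
open import Data.Sum.Base using (_⊎_; inj₁; inj₂)
open import Data.Vec.Base using (lookup; tabulate)
open import Data.Vec.Properties using (lookup∘tabulate)
open import Function.Base using (_∘_; const; id)
open import Function.Bundles using (Func)
open import Level using (0ℓ)
open import Relation.Binary.Core using (REL)
open import Relation.Binary.Definitions using (Decidable)
open import Relation.Binary.PropositionalEquality.Core as ≡ using (_≡_)
open import Relation.Nullary.Decidable using (Dec; does; yes; no; from-yes; _×-dec_)
open import Relation.Nullary.Negation.Core using (contradiction)

-- Finite sums, and divergence under relations and homomorphisms.

module _ {c ℓ} (M : CommutativeMonoid c ℓ) where
  open CommutativeMonoid M
  open Sum M

  sum-δ : ∀ {n} (f : Fin n → Carrier) i →
          sum (λ j → if does (i ≟ j) then f j else ε) ≈ f i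
  sum-δ {ℕ.suc n} f zero = trans (∙-congˡ (sum-replicate-zero n)) (identityʳ _)
  sum-δ           f (suc i) = trans (identityˡ _) (sum-δ (f ∘ suc) i)

module _ {a ℓ₁ b ℓ₂} (A : AbelianGroup a ℓ₁) (B : AbelianGroup b ℓ₂) where
  private
    module A  = AbelianGroup A
    module B  = AbelianGroup B
    module PB = AbelianGroupProperties B
    module ΣA = Sum A.commutativeMonoid
    module ΣB = Sum B.commutativeMonoid

  module _ {r} (_~_ : REL A.Carrier B.Carrier r)
    (ε~ε : A.ε ~ B.ε)
    (∙-resp-~ : ∀ {x y x′ y′} → x ~ y → x′ ~ y′ → (x A.∙ x′) ~ (y B.∙ y′))
    (⁻¹-resp-~ : ∀ {x y} → x ~ y → (x A.⁻¹) ~ (y B.⁻¹))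
    where

    sum-resp-~ : ∀ {n} (f : Fin n → A.Carrier) (g : Fin n → B.Carrier) →
                 (∀ i → f i ~ g i) → ΣA.sum f ~ ΣB.sum g
    sum-resp-~ {ℕ.zero}  f g f~g = ε~ε
    sum-resp-~ {ℕ.suc n} f g f~g =
      ∙-resp-~ (f~g zero) (sum-resp-~ (f ∘ suc) (g ∘ suc) (f~g ∘ suc))

    -- Phrased for a relation because it serves three purposes: the graph of a homomorphism,
    -- evaluation of a function-valued flow at one coordinate, and congruence of a residue with an
    -- integer.
    divergence-resp-~ :
      ∀ G (φ : Graph.E G → A.Carrier) (ψ : Graph.E G → B.Carrier) → (∀ e → φ e ~ ψ e) →
      ∀ v → (outSum A G φ v A.- inSum A G φ v) ~ (outSum B G ψ v B.- inSum B G ψ v)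
    divergence-resp-~ G φ ψ φ~ψ v = ∙-resp-~ (at src) (⁻¹-resp-~ (at tgt))
      where
      open Graph G
      if-resp-~ : ∀ b {x y} → x ~ y → (if b then x else A.ε) ~ (if b then y else B.ε)
      if-resp-~ true  x~y = x~y
      if-resp-~ false x~y = ε~ε
      at : ∀ end → ΣA.sum (λ e → if does (end e ≟ v) then φ e else A.ε) ~
                   ΣB.sum (λ e → if does (end e ≟ v) then ψ e else B.ε)
      at end = sum-resp-~ _ _ λ e → if-resp-~ (does (end e ≟ v)) (φ~ψ e)

  module _ (h : A.Carrier → B.Carrier)
    (h-cong : ∀ {x y} → x A.≈ y → h x B.≈ h y)
    (h-∙ : ∀ x y → h (x A.∙ y) B.≈ h x B.∙ h y)
    where

    homo-ε : h A.ε B.≈ B.ε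
    homo-ε = PB.identityʳ-unique (h A.ε) (h A.ε)
      (B.trans (B.sym (h-∙ A.ε A.ε)) (h-cong (A.identityˡ A.ε)))

    homo-⁻¹ : ∀ x → h (x A.⁻¹) B.≈ h x B.⁻¹
    homo-⁻¹ x = PB.inverseˡ-unique (h (x A.⁻¹)) (h x)
      (B.trans (B.sym (h-∙ (x A.⁻¹) x)) (B.trans (h-cong (A.inverseˡ x)) homo-ε))

    homo-- : ∀ x y → h (x A.- y) B.≈ h x B.- h y
    homo-- x y = B.trans (h-∙ x (y A.⁻¹)) (B.∙-congˡ (homo-⁻¹ y))

    flow-homo : ∀ G (φ : Graph.E G → A.Carrier) → IsFlow A G φ → IsFlow B G (h ∘ φ)
    flow-homo G φ flow v = B.trans (B.sym image) (B.trans (h-cong (flow v)) homo-ε)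
      where
      image : h (outSum A G φ v A.- inSum A G φ v) B.≈
              outSum B G (h ∘ φ) v B.- inSum B G (h ∘ φ) v
      image = divergence-resp-~ (λ x y → h x B.≈ y) homo-ε
        (λ p q → B.trans (h-∙ _ _) (B.∙-cong p q))
        (λ p → B.trans (homo-⁻¹ _) (B.⁻¹-cong p))
        G φ (h ∘ φ) (λ _ → B.refl) v

-- Integer multiples and the reduction to the universal target.

ℤ⁺ : AbelianGroup 0ℓ 0ℓ
ℤ⁺ = ℤ.+-0-abelianGroup

module _ {c ℓ} (A : AbelianGroup c ℓ) where
  open AbelianGroup A
  open AbelianGroupProperties A
  open Mult monoid using (×-homo-+) renaming (_×_ to _×′_)
  open import Relation.Binary.Reasoning.Setoid setoid

  infixr 8 _·_
  _·_ : ℤ → Carrier → Carrier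
  (+ m)    · x = m ×′ x
  -[1+ m ] · x = (ℕ.suc m ×′ x) ⁻¹

  ·-⊖ : ∀ x m n → (m ⊖ n) · x ≈ m ×′ x - n ×′ x
  ·-⊖ x m ℕ.zero = sym (trans (∙-congˡ ε⁻¹≈ε) (identityʳ _))
  ·-⊖ x ℕ.zero (ℕ.suc n) = sym (identityˡ _)
  ·-⊖ x (ℕ.suc m) (ℕ.suc n) = begin
    (ℕ.suc m ⊖ ℕ.suc n) · x            ≡⟨ ≡.cong (_· x) (ℤ.[1+m]⊖[1+n]≡m⊖n m n) ⟩
    (m ⊖ n) · x                        ≈⟨ ·-⊖ x m n ⟩
    m ×′ x - n ×′ x                    ≈⟨ xyx⁻¹≈y x _ ⟨
    x ∙ (m ×′ x - n ×′ x) - x          ≈⟨ ∙-congʳ (assoc x _ _) ⟨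
    x ∙ m ×′ x ∙ (n ×′ x) ⁻¹ - x       ≈⟨ assoc _ _ _ ⟩
    x ∙ m ×′ x ∙ ((n ×′ x) ⁻¹ ∙ x ⁻¹)  ≈⟨ ∙-congˡ (⁻¹-anti-homo-∙ x _) ⟨
    x ∙ m ×′ x - (x ∙ n ×′ x)          ∎

  ·-homo-+ : ∀ x i j → (i ℤ.+ j) · x ≈ i · x ∙ j · x
  ·-homo-+ x (+ m)    (+ n)    = ×-homo-+ x m n
  ·-homo-+ x (+ m)    -[1+ n ] = ·-⊖ x m (ℕ.suc n)
  ·-homo-+ x -[1+ m ] (+ n)    = trans (·-⊖ x n (ℕ.suc m)) (comm _ _)
  ·-homo-+ x -[1+ m ] -[1+ n ] = begin
    (ℕ.suc (ℕ.suc (m ℕ.+ n)) ×′ x) ⁻¹          ≡⟨ ≡.cong (λ k → (k ×′ x) ⁻¹) (≡.cong ℕ.suc (ℕ.+-suc m n)) ⟨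
    ((ℕ.suc m ℕ.+ ℕ.suc n) ×′ x) ⁻¹            ≈⟨ ⁻¹-cong (×-homo-+ x (ℕ.suc m) (ℕ.suc n)) ⟩
    (ℕ.suc m ×′ x ∙ ℕ.suc n ×′ x) ⁻¹           ≈⟨ ⁻¹-∙-comm _ _ ⟨
    (ℕ.suc m ×′ x) ⁻¹ ∙ (ℕ.suc n ×′ x) ⁻¹      ∎

δ : ∀ {n} → Fin n → Fin n → ℤ
δ a i = if does (a ≟ i) then + 1 else 0ℤ

module _ {c ℓ} (M : AbelianGroup c ℓ) {n} (g : Fin n → AbelianGroup.Carrier M) where
  open AbelianGroup M using (Carrier; _∙_; _≈_; sym)

  -- An edge of the Cayley graph of `M`, seen as its boundary vector. The labelling `g` gives a
  -- finite index set to search even when the carrier is a product.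
  Arc : Carrier → (Fin n → ℤ) → Set ℓ
  Arc x c = ∃[ a ] ∃[ b ] (g a ∙ x) ≈ g b × (∀ i → c i ≡ δ b i ℤ.- δ a i)

  ArcFlow : (G : Graph) → (Graph.E G → Carrier) → Set ℓ
  ArcFlow G φ = ∃ λ (c : Fin n → Graph.E G → ℤ) →
    (∀ i → IsFlow ℤ⁺ G (c i)) × (∀ e → Arc (φ e) (λ i → c i e))

  -- The vectors `δ a` form a basis of `ℤⁿ`, so `to ∘ g` extends to a homomorphism `h`. It carries
  -- flows to flows and an arc from `a` to `b` to the difference of the values of `m` at its ends.
  arcFlows⇒strongHomomorphism : ∀ G → (∀ φ → IsFlow M G φ → ArcFlow G φ) →
                                ∀ {c′ ℓ′} → StrongHomomorphismProperty c′ ℓ′ G M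
  arcFlows⇒strongHomomorphism G arcFlow M′ m φ φ-flow =
    h ∘ (λ e i → coeff i e) , flow-homo ℤⁿ M′ h h-cong h-∙ G _ ℤⁿ-flow , λ e → arc⇒∈ℋ (arc e)
    where
    open Func m
    module M′ = AbelianGroup M′
    open Sum M′.commutativeMonoid
    coeff = proj₁ (arcFlow φ φ-flow)
    coeff-flow = proj₁ (proj₂ (arcFlow φ φ-flow))
    arc = proj₂ (proj₂ (arcFlow φ φ-flow))

    ℤⁿ : AbelianGroup 0ℓ 0ℓ
    ℤⁿ = Pointwise.abelianGroup (Fin n) ℤ⁺

    h : (Fin n → ℤ) → M′.Carrier
    h c = sum λ i → _·_ M′ (c i) (to (g i))

    h-cong : ∀ {c d} → (∀ i → c i ≡ d i) → h c M′.≈ h d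
    h-cong c≡d = sum-cong-≋ λ i → M′.reflexive (≡.cong (λ k → _·_ M′ k (to (g i))) (c≡d i))

    h-∙ : ∀ c d → h (λ i → c i ℤ.+ d i) M′.≈ h c M′.∙ h d
    h-∙ c d = M′.trans (sum-cong-≋ λ i → ·-homo-+ M′ (to (g i)) (c i) (d i))
      (∑-distrib-+ (λ i → _·_ M′ (c i) (to (g i))) (λ i → _·_ M′ (d i) (to (g i))))

    h-δ : ∀ a → h (δ a) M′.≈ to (g a)
    h-δ a = M′.trans (sum-cong-≋ λ i → if-· (does (a ≟ i)) (to (g i)))
                     (sum-δ M′.commutativeMonoid (to ∘ g) a)
      where
      if-· : ∀ b x → _·_ M′ (if b then + 1 else 0ℤ) x M′.≈ (if b then x else M′.ε)
      if-· true  x = M′.identityʳ x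
      if-· false x = M′.refl

    arc⇒∈ℋ : ∀ {x c} → Arc x c → ℋ M M′ m x (h c)
    arc⇒∈ℋ {x} {c} (a , b , ax≈b , c≡) = g a , (begin
      h c                            ≈⟨ h-cong c≡ ⟩
      h (λ i → δ b i ℤ.- δ a i)      ≈⟨ homo-- ℤⁿ M′ h h-cong h-∙ (δ b) (δ a) ⟩
      h (δ b) M′.- h (δ a)           ≈⟨ M′.∙-cong (h-δ b) (M′.⁻¹-cong (h-δ a)) ⟩
      to (g b) M′.- to (g a)         ≈⟨ M′.∙-congʳ (cong ax≈b) ⟨
      to (g a ∙ x) M′.- to (g a)     ∎)
      where open import Relation.Binary.Reasoning.Setoid M′.setoid

    ℤⁿ-flow : IsFlow ℤⁿ G (λ e i → coeff i e)
    ℤⁿ-flow v i = ≡.trans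
      (divergence-resp-~ ℤⁿ ℤ⁺ (λ f k → f i ≡ k) ≡.refl (≡.cong₂ ℤ._+_) (≡.cong (λ k → ℤ.- k))
        G (λ e i → coeff i e) (coeff i) (λ _ → ≡.refl) v)
      (coeff-flow i v)

-- Integer demands summed over vertex sets.

open import Data.Integer.Base using (_+_; _-_; -_; _*_; _≤_; _<_; +≤+; +<+; -≤+)
open import Data.Integer.Properties hiding (_≟_)
open ≡ using (refl; sym; trans; cong; cong₂; subst)
open SemiringSum +-*-semiring
  using (sum; sum-cong-≗; ∑-distrib-+; ∑-comm; *-distribˡ-sum; *-distribʳ-sum)

sum-mono-≤ : ∀ {n} {f g : Fin n → ℤ} → (∀ i → f i ≤ g i) → sum f ≤ sum g
sum-mono-≤ {ℕ.zero}  f≤g = ≤-refl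
sum-mono-≤ {ℕ.suc n} f≤g = +-mono-≤ (f≤g zero) (sum-mono-≤ (f≤g ∘ suc))

𝟙 : Bool → ℤ
𝟙 true  = 1ℤ
𝟙 false = 0ℤ

if≡*𝟙 : ∀ b i → (if b then i else 0ℤ) ≡ i * 𝟙 b
if≡*𝟙 true  i = sym (*-identityʳ i)
if≡*𝟙 false i = sym (*-zeroʳ i)

sum-*𝟙 : ∀ {n} (f : Fin n → ℤ) i → sum (λ j → f j * 𝟙 (does (i ≟ j))) ≡ f i
sum-*𝟙 f i = trans (sum-cong-≗ λ j → sym (if≡*𝟙 (does (i ≟ j)) (f j)))
                   (sum-δ +-0-commutativeMonoid f i)

module _ {n : ℕ} where

  ∂ : Fin n → Fin n → Fin n → ℤ
  ∂ s t v = 𝟙 (does (s ≟ v)) - 𝟙 (does (t ≟ v))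

  total : (Fin n → Bool) → (Fin n → ℤ) → ℤ
  total χ d = sum λ v → d v * 𝟙 (χ v)

  total-cong : ∀ χ {d d′} → (∀ v → d v ≡ d′ v) → total χ d ≡ total χ d′
  total-cong χ d≡d′ = sum-cong-≗ λ v → cong (_* 𝟙 (χ v)) (d≡d′ v)

  total-+ : ∀ χ d d′ → total χ (λ v → d v + d′ v) ≡ total χ d + total χ d′
  total-+ χ d d′ = trans
    (sum-cong-≗ λ v → *-distribʳ-+ (𝟙 (χ v)) (d v) (d′ v))
    (∑-distrib-+ (λ v → d v * 𝟙 (χ v)) (λ v → d′ v * 𝟙 (χ v)))

  total-* : ∀ χ d k → total χ (λ v → d v * k) ≡ total χ d * k
  total-* χ d k = trans
    (sum-cong-≗ λ v → swap (d v) k (𝟙 (χ v)))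
    (sym (*-distribʳ-sum k (λ v → d v * 𝟙 (χ v))))
    where
    swap : ∀ x y z → x * y * z ≡ x * z * y
    swap = solve-∀

  total-- : ∀ χ d d′ → total χ (λ v → d v - d′ v) ≡ total χ d - total χ d′
  total-- χ d d′ = begin-equality
    total χ (λ v → d v - d′ v)              ≡⟨ total-+ χ d (λ v → - d′ v) ⟩
    total χ d + total χ (λ v → - d′ v)      ≡⟨ cong (λ x → total χ d + x) (total-cong χ λ v → neg (d′ v)) ⟩
    total χ d + total χ (λ v → d′ v * -1ℤ)  ≡⟨ cong (λ x → total χ d + x) (total-* χ d′ -1ℤ) ⟩
    total χ d + total χ d′ * -1ℤ            ≡⟨ cong (λ x → total χ d + x) (neg (total χ d′)) ⟨
    total χ d - total χ d′                  ∎
    where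
    open ≤-Reasoning
    neg : ∀ x → - x ≡ x * -1ℤ
    neg x = trans (sym (-1*i≡-i x)) (*-comm -1ℤ x)

  total-∂ : ∀ χ s t → total χ (∂ s t) ≡ 𝟙 (χ s) - 𝟙 (χ t)
  total-∂ χ s t = trans (total-- χ (at s) (at t)) (cong₂ _-_ (total-at s) (total-at t))
    where
    at : Fin n → Fin n → ℤ
    at u v = 𝟙 (does (u ≟ v))
    total-at : ∀ u → total χ (at u) ≡ 𝟙 (χ u)
    total-at u = trans (sum-cong-≗ λ v → *-comm (at u v) (𝟙 (χ v))) (sum-*𝟙 (𝟙 ∘ χ) u)

  -- Modularity of demands, to be played against the submodularity of `capacity`.
  total-∪∩ : ∀ χ χ′ d →
    total (λ v → χ v ∨ χ′ v) d + total (λ v → χ v ∧ χ′ v) d ≡ total χ d + total χ′ d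
  total-∪∩ χ χ′ d = begin-equality
    total (λ v → χ v ∨ χ′ v) d + total (λ v → χ v ∧ χ′ v) d
      ≡⟨ ∑-distrib-+ (λ v → d v * 𝟙 (χ v ∨ χ′ v)) (λ v → d v * 𝟙 (χ v ∧ χ′ v)) ⟨
    sum (λ v → d v * 𝟙 (χ v ∨ χ′ v) + d v * 𝟙 (χ v ∧ χ′ v))
      ≡⟨ sum-cong-≗ (λ v → at (d v) (χ v) (χ′ v)) ⟩
    sum (λ v → d v * 𝟙 (χ v) + d v * 𝟙 (χ′ v))
      ≡⟨ ∑-distrib-+ (λ v → d v * 𝟙 (χ v)) (λ v → d v * 𝟙 (χ′ v)) ⟩
    total χ d + total χ′ d ∎
    where
    open ≤-Reasoning
    at : ∀ x a b → x * 𝟙 (a ∨ b) + x * 𝟙 (a ∧ b) ≡ x * 𝟙 a + x * 𝟙 b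
    at x true  b = refl
    at x false b = +-comm (x * 𝟙 b) (x * 0ℤ)

  total-single : ∀ d v → total (λ u → does (v ≟ u)) d ≡ d v
  total-single = sum-*𝟙

  total-∁ : ∀ χ d → total χ d + total (not ∘ χ) d ≡ total (const true) d
  total-∁ χ d = trans
    (sym (∑-distrib-+ (λ v → d v * 𝟙 (χ v)) (λ v → d v * 𝟙 (not (χ v)))))
    (sum-cong-≗ λ v → at (d v) (χ v))
    where
    at : ∀ x b → x * 𝟙 b + x * 𝟙 (not b) ≡ x * 1ℤ
    at x true  = trans (cong (λ y → x * 1ℤ + y) (*-zeroʳ x)) (+-identityʳ _)
    at x false = trans (cong (_+ x * 1ℤ) (*-zeroʳ x)) (+-identityˡ _)

-- Directed cuts and integral transport.

-- One edge's share of a directed cut: `c` tells whether the edge may be used, `a` and `b` whether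
-- its source and its target lie inside.
leaving : Bool → Bool → Bool → ℤ
leaving c a b = 𝟙 (c ∧ (a ∧ not b))

-- Strict only for a usable edge between the two set differences: it leaves one of the sets, but
-- neither the union nor the intersection.
leaving-submodular : ∀ c a b a′ b′ →
  leaving c (a ∨ a′) (b ∨ b′) + leaving c (a ∧ a′) (b ∧ b′) ≤ leaving c a b + leaving c a′ b′
leaving-submodular false a     b     a′    b′    = ≤-refl
leaving-submodular true  false b     false b′    = ≤-refl
leaving-submodular true  false true  true  true  = ≤-refl
leaving-submodular true  false true  true  false = +≤+ ℕ.z≤n
leaving-submodular true  false false true  b′    = ≤-reflexive (+-comm (𝟙 (not b′)) 0ℤ)
leaving-submodular true  true  true  false b′    = ≤-refl
leaving-submodular true  true  false false true  = +≤+ ℕ.z≤n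
leaving-submodular true  true  false false false = ≤-refl
leaving-submodular true  true  true  true  b′    = ≤-refl
leaving-submodular true  true  false true  b′    = ≤-reflexive (+-comm (𝟙 (not b′)) 1ℤ)

leaving-positive : ∀ c a b {i} → i < leaving c a b + i → c ≡ true × a ≡ true × b ≡ false
leaving-positive false a     b     i<i = contradiction (sym (+-identityˡ _)) (<⇒≢ i<i)
leaving-positive true  false b     i<i = contradiction (sym (+-identityˡ _)) (<⇒≢ i<i)
leaving-positive true  true  true  i<i = contradiction (sym (+-identityˡ _)) (<⇒≢ i<i)
leaving-positive true  true  false _   = refl , refl , refl

𝟙-not : ∀ b → 𝟙 (not b) ≡ 1ℤ - 𝟙 b
𝟙-not true  = refl
𝟙-not false = refl

module _ {n : ℕ} where

  div : ∀ {k} (s t : Fin k → Fin n) → (Fin k → ℤ) → Fin n → ℤ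
  div s t φ v = sum λ e → φ e * ∂ (s e) (t e) v

  capacity : ∀ {k} (s t : Fin k → Fin n) → (Fin k → Bool) → (Fin n → Bool) → ℤ
  capacity s t cap χ = sum λ e → leaving (cap e) (χ (s e)) (χ (t e))

  capacity-submodular : ∀ {k} (s t : Fin k → Fin n) cap χ χ′ →
    capacity s t cap (λ v → χ v ∨ χ′ v) + capacity s t cap (λ v → χ v ∧ χ′ v) ≤
    capacity s t cap χ + capacity s t cap χ′
  capacity-submodular s t cap χ χ′ = begin
    sum (at ∪) + sum (at ∩)
      ≡⟨ ∑-distrib-+ (at ∪) (at ∩) ⟨
    sum (λ e → at ∪ e + at ∩ e)
      ≤⟨ sum-mono-≤ (λ e → leaving-submodular (cap e) (χ (s e)) (χ (t e)) (χ′ (s e)) (χ′ (t e))) ⟩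
    sum (λ e → at χ e + at χ′ e)
      ≡⟨ ∑-distrib-+ (at χ) (at χ′) ⟩
    sum (at χ) + sum (at χ′) ∎
    where
    open ≤-Reasoning
    ∪ ∩ : Fin n → Bool
    ∪ v = χ v ∨ χ′ v
    ∩ v = χ v ∧ χ′ v
    at = λ χ e → leaving (cap e) (χ (s e)) (χ (t e))

  -- Gale's feasible flow theorem for capacities 0 and 1, with `x` the set of edges that carry a
  -- unit.
  satisfy-demand : ∀ {k} (s t : Fin k → Fin n) (cap : Fin k → Bool) (d : Fin n → ℤ) →
    total (const true) d ≡ 0ℤ → (∀ χ → total χ d ≤ capacity s t cap χ) →
    ∃[ x ] (∀ e → x e ≡ true → cap e ≡ true) × (∀ v → d v ≡ div s t (𝟙 ∘ x) v)
  satisfy-demand {ℕ.zero} s t cap d d-total cut = (λ ()) , (λ ()) , λ v →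
    -- Without edges all cuts have capacity 0. The singleton of `v` bounds `d v` from above; its
    -- complement, as all demands add up to 0, bounds it from below.
    ≤-antisym (subst (_≤ 0ℤ) (total-single d v) (cut _)) (begin
      0ℤ                                            ≡⟨ d-total ⟨
      total (const true) d                          ≡⟨ total-∁ (is v) d ⟨
      total (is v) d + total (not ∘ is v) d         ≤⟨ +-monoʳ-≤ (total (is v) d) (cut _) ⟩
      total (is v) d + 0ℤ                           ≡⟨ +-identityʳ _ ⟩
      total (is v) d                                ≡⟨ total-single d v ⟩
      d v                                           ∎)
    where
    open ≤-Reasoning
    is : Fin n → Fin n → Bool
    is v u = does (v ≟ u)
  satisfy-demand {ℕ.suc k} s t cap d d-total cut
    with anySubset? (λ R → capacity (s ∘ suc) (t ∘ suc) (cap ∘ suc) (lookup R) <?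
                           total (lookup R) d)
  ... | no ¬violated = x , x≤cap , λ v → trans (d≡ v) (sym (+-identityˡ _))
    where
    open ≤-Reasoning
    rest = capacity (s ∘ suc) (t ∘ suc) (cap ∘ suc)
    cut′ : ∀ χ → total χ d ≤ rest χ
    -- The search runs over subsets stored as vectors, so a violating `χ` is tabulated first.
    cut′ χ = ≮⇒≥ λ rest<total → ¬violated (tabulate χ , (begin-strict
      rest (lookup (tabulate χ))
        ≡⟨ sum-cong-≗ (λ e → cong₂ (leaving (cap (suc e))) (lookup∘tabulate χ (s (suc e)))
                                                           (lookup∘tabulate χ (t (suc e)))) ⟩
      rest χ
        <⟨ rest<total ⟩
      total χ d
        ≡⟨ sum-cong-≗ (λ v → cong (λ b → d v * 𝟙 b) (lookup∘tabulate χ v)) ⟨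
      total (lookup (tabulate χ)) d ∎))
    IH = satisfy-demand (s ∘ suc) (t ∘ suc) (cap ∘ suc) d d-total cut′
    x : Fin (ℕ.suc k) → Bool
    x zero    = false
    x (suc e) = proj₁ IH e
    x≤cap : ∀ e → x e ≡ true → cap e ≡ true
    x≤cap (suc e) = proj₁ (proj₂ IH) e
    d≡ = proj₂ (proj₂ IH)
  ... | yes (R , violated) = x , x≤cap , λ v →
      trans (split (d v) (∂s₀t₀ v)) (cong (λ y → 1ℤ * ∂s₀t₀ v + y) (d≡ v))
    where
    open ≤-Reasoning
    rest = capacity (s ∘ suc) (t ∘ suc) (cap ∘ suc)
    s₀ = s zero
    t₀ = t zero
    ∂s₀t₀ = ∂ s₀ t₀
    ρ = lookup R
    d′ : Fin n → ℤ
    d′ v = d v - ∂s₀t₀ v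
    split : ∀ i j → i ≡ 1ℤ * j + (i - j)
    split = solve-∀
    -- The cut `ρ` meets its demand with the first edge but not without it, so this edge is usable
    -- and leaves `ρ`.
    tight : cap zero ≡ true × ρ s₀ ≡ true × ρ t₀ ≡ false
    tight = leaving-positive (cap zero) (ρ s₀) (ρ t₀) (<-≤-trans violated (cut ρ))
    total-d′ : ∀ χ → total χ d′ ≡ total χ d - (𝟙 (χ s₀) - 𝟙 (χ t₀))
    total-d′ χ = trans (total-- χ d ∂s₀t₀) (cong (λ x → total χ d - x) (total-∂ χ s₀ t₀))
    d′-total : total (const true) d′ ≡ 0ℤ
    d′-total = trans (total-d′ (const true)) (cong (_- 0ℤ) d-total)
    cut′ : ∀ χ → total χ d′ ≤ rest χ
    -- Uncrossing. Were `χ` violated for `d′`, the two strict inequalities, for `ρ` and `χ`, would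
    -- give an excess of 2 over the remaining capacities. The union and the intersection allow an
    -- excess of only 1: the first edge adds `1 - τ` to one and `σ` to the other, and the change of
    -- demand accounts for `σ - τ`.
    cut′ χ = ≮⇒≥ λ rest<total → <-irrefl refl (begin-strict
      1ℤ + (σ - τ + (rest ρ + rest χ))
        <⟨ +-monoˡ-< (σ - τ + (rest ρ + rest χ)) (+<+ (ℕ.s≤s (ℕ.s≤s ℕ.z≤n))) ⟩
      + 2 + (σ - τ + (rest ρ + rest χ))
        ≡⟨ arrange₁ (rest ρ) (rest χ) (σ - τ) ⟩
      (1ℤ + rest ρ) + ((1ℤ + rest χ) + (σ - τ))
        ≤⟨ +-mono-≤ (i<j⇒suc[i]≤j violated) (+-monoˡ-≤ (σ - τ) (i<j⇒suc[i]≤j rest<total)) ⟩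
      total ρ d + (total χ d′ + (σ - τ))
        ≡⟨ cong (λ y → total ρ d + (y + (σ - τ))) (total-d′ χ) ⟩
      total ρ d + ((total χ d - (σ - τ)) + (σ - τ))
        ≡⟨ arrange₂ (total ρ d) (total χ d) (σ - τ) ⟩
      total ρ d + total χ d
        ≡⟨ total-∪∩ ρ χ d ⟨
      total ∪ d + total ∩ d
        ≤⟨ +-mono-≤ (cut ∪) (cut ∩) ⟩
      (leaving (cap zero) (∪ s₀) (∪ t₀) + rest ∪) + (leaving (cap zero) (∩ s₀) (∩ t₀) + rest ∩)
        ≡⟨ cong₂ (λ y z → (y + rest ∪) + (z + rest ∩)) ∪-leaving ∩-leaving ⟩
      ((1ℤ - τ) + rest ∪) + (σ + rest ∩)
        ≡⟨ arrange₃ σ τ (rest ∪) (rest ∩) ⟩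
      1ℤ + (σ - τ + (rest ∪ + rest ∩))
        ≤⟨ +-monoʳ-≤ 1ℤ (+-monoʳ-≤ (σ - τ) (capacity-submodular (s ∘ suc) (t ∘ suc) (cap ∘ suc) ρ χ)) ⟩
      1ℤ + (σ - τ + (rest ρ + rest χ)) ∎)
      where
      ∪ ∩ : Fin n → Bool
      ∪ v = ρ v ∨ χ v
      ∩ v = ρ v ∧ χ v
      σ = 𝟙 (χ s₀)
      τ = 𝟙 (χ t₀)
      arrange₁ : ∀ i j k → + 2 + (k + (i + j)) ≡ (1ℤ + i) + ((1ℤ + j) + k)
      arrange₁ = solve-∀
      arrange₂ : ∀ i j k → i + ((j - k) + k) ≡ i + j
      arrange₂ = solve-∀
      arrange₃ : ∀ i j k l → ((1ℤ - j) + k) + (i + l) ≡ 1ℤ + (i - j + (k + l))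
      arrange₃ = solve-∀
      ∪-leaving : leaving (cap zero) (∪ s₀) (∪ t₀) ≡ 1ℤ - τ
      ∪-leaving rewrite proj₁ tight | proj₁ (proj₂ tight) | proj₂ (proj₂ tight) = 𝟙-not (χ t₀)
      ∩-leaving : leaving (cap zero) (∩ s₀) (∩ t₀) ≡ σ
      ∩-leaving rewrite proj₁ tight | proj₁ (proj₂ tight) | proj₂ (proj₂ tight) =
        cong 𝟙 (∧-identityʳ (χ s₀))
    IH = satisfy-demand (s ∘ suc) (t ∘ suc) (cap ∘ suc) d′ d′-total cut′
    x : Fin (ℕ.suc k) → Bool
    x zero    = true
    x (suc e) = proj₁ IH e
    x≤cap : ∀ e → x e ≡ true → cap e ≡ true
    x≤cap zero _ = proj₁ tight
    x≤cap (suc e) = proj₁ (proj₂ IH) e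
    d≡ = proj₂ (proj₂ IH)

-- Rounding integer chains to circulations.

nonZeroᵇ : ℕ → Bool
nonZeroᵇ ℕ.zero    = false
nonZeroᵇ (ℕ.suc _) = true

-- The cut condition edge by edge, scaled by `k`: an edge with nonzero residue has capacity 1, worth
-- `k`, which dominates the residue that it carries out.
residue≤leaving : ∀ {r k} a b → r ℕ.≤ k →
                  + r * (𝟙 a - 𝟙 b) ≤ leaving (nonZeroᵇ r) a b * + k
residue≤leaving {ℕ.zero}  a     b     r≤k = ≤-refl
residue≤leaving {ℕ.suc r} true  true  r≤k = ≤-reflexive (*-zeroʳ (+ ℕ.suc r))
residue≤leaving {ℕ.suc r} {k} true false r≤k = begin
  + ℕ.suc r * 1ℤ  ≡⟨ *-identityʳ _ ⟩
  + ℕ.suc r       ≤⟨ +≤+ r≤k ⟩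
  + k             ≡⟨ *-identityˡ (+ k) ⟨
  1ℤ * + k        ∎
  where open ≤-Reasoning
residue≤leaving {ℕ.suc r} false true  r≤k = -≤+
residue≤leaving {ℕ.suc r} false false r≤k = ≤-reflexive (*-zeroʳ (+ ℕ.suc r))

-- The integers j with ∣ i + j * k ∣ < k.
roundings : (k : ℕ) .{{_ : ℕ.NonZero k}} → ℤ → List ℤ
roundings k i = - (i /ℕ k) ∷ (if nonZeroᵇ (i %ℕ k) then - (i /ℕ k) - 1ℤ ∷ [] else [])

-- `b` chooses between the residue and the residue minus `k`; the latter has absolute value below
-- `k` only if the residue is nonzero.
∈-roundings : ∀ k .{{_ : ℕ.NonZero k}} i b → (b ≡ true → nonZeroᵇ (i %ℕ k) ≡ true) →
              - (i /ℕ k) - 𝟙 b ∈ roundings k i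
∈-roundings k i false _ = here (+-identityʳ _)
∈-roundings k i true  r≢0 rewrite r≢0 refl = there (here refl)

module _ {n k : ℕ} (s t : Fin k → Fin n) where

  Circulation : (Fin k → ℤ) → Set
  Circulation φ = ∀ v → div s t φ v ≡ 0ℤ

  div-cong : ∀ {φ ψ} → (∀ e → φ e ≡ ψ e) → ∀ v → div s t φ v ≡ div s t ψ v
  div-cong φ≡ψ v = sum-cong-≗ λ e → cong (_* ∂ (s e) (t e) v) (φ≡ψ e)

  div-+ : ∀ φ ψ v → div s t (λ e → φ e + ψ e) v ≡ div s t φ v + div s t ψ v
  div-+ φ ψ v = trans
    (sum-cong-≗ λ e → *-distribʳ-+ (∂ (s e) (t e) v) (φ e) (ψ e))
    (∑-distrib-+ (λ e → φ e * ∂ (s e) (t e) v) (λ e → ψ e * ∂ (s e) (t e) v))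

  div-* : ∀ φ q v → div s t (λ e → φ e * q) v ≡ div s t φ v * q
  div-* φ q v = trans
    (sum-cong-≗ λ e → swap (φ e) q (∂ (s e) (t e) v))
    (sym (*-distribʳ-sum q (λ e → φ e * ∂ (s e) (t e) v)))
    where
    swap : ∀ x y z → x * y * z ≡ x * z * y
    swap = solve-∀

  total-div : ∀ χ φ → total χ (div s t φ) ≡ sum (λ e → φ e * (𝟙 (χ (s e)) - 𝟙 (χ (t e))))
  total-div χ φ = begin-equality
    sum (λ v → sum (λ e → φ e * ∂ (s e) (t e) v) * 𝟙 (χ v))
      ≡⟨ sum-cong-≗ (λ v → *-distribʳ-sum (𝟙 (χ v)) (λ e → φ e * ∂ (s e) (t e) v)) ⟩
    sum (λ v → sum (λ e → φ e * ∂ (s e) (t e) v * 𝟙 (χ v)))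
      ≡⟨ ∑-comm (λ v e → φ e * ∂ (s e) (t e) v * 𝟙 (χ v)) ⟩
    sum (λ e → sum (λ v → φ e * ∂ (s e) (t e) v * 𝟙 (χ v)))
      ≡⟨ sum-cong-≗ (λ e → sum-cong-≗ λ v → *-assoc (φ e) (∂ (s e) (t e) v) (𝟙 (χ v))) ⟩
    sum (λ e → sum (λ v → φ e * (∂ (s e) (t e) v * 𝟙 (χ v))))
      ≡⟨ sum-cong-≗ (λ e → *-distribˡ-sum (φ e) (λ v → ∂ (s e) (t e) v * 𝟙 (χ v))) ⟨
    sum (λ e → φ e * total χ (∂ (s e) (t e)))
      ≡⟨ sum-cong-≗ (λ e → cong (φ e *_) (total-∂ χ (s e) (t e))) ⟩
    sum (λ e → φ e * (𝟙 (χ (s e)) - 𝟙 (χ (t e)))) ∎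
    where open ≤-Reasoning

  -- Quotients are stored as members of a finite list, which is what the case checks run through;
  -- they also reappear as coefficients of arcs.
  record Rounding (q : ℕ) .{{_ : ℕ.NonZero q}} (ψ : Fin k → ℤ) : Set where
    constructor rounding
    field
      quotients  : Fin k → ℤ
      ∈roundings : ∀ e → quotients e ∈ roundings q (ψ e)
    rounded : Fin k → ℤ
    rounded e = ψ e + quotients e * + q
    field
      circulation : Circulation rounded

  -- Write `ψ = r + u q` with residues `r`. The divergence of `r` is `q` times a demand `d`. Once
  -- `d` is routed by a set `x` of edges with nonzero residue, `r - q x` is a circulation.
  round : ∀ q .{{_ : ℕ.NonZero q}} ψ → (∀ v → + q ∣ div s t ψ v) → Rounding q ψ
  round q@(ℕ.suc _) ψ q∣div = rounding τ τ∈ circ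
    where
    open ≤-Reasoning
    r : Fin k → ℕ
    r e = ψ e %ℕ q
    u : Fin k → ℤ
    u e = ψ e /ℕ q
    cap : Fin k → Bool
    cap e = nonZeroᵇ (r e)
    d : Fin n → ℤ
    d v = quotient (q∣div v) - div s t u v

    div-r : ∀ v → div s t (+_ ∘ r) v ≡ d v * + q
    div-r v = begin-equality
      div s t (+_ ∘ r) v
        ≡⟨ drop-+ _ (div s t u v * + q) ⟩
      div s t (+_ ∘ r) v + div s t u v * + q - div s t u v * + q
        ≡⟨ cong (λ x → div s t (+_ ∘ r) v + x - div s t u v * + q) (div-* u (+ q) v) ⟨
      div s t (+_ ∘ r) v + div s t (λ e → u e * + q) v - div s t u v * + q
        ≡⟨ cong (_- div s t u v * + q) (div-+ (+_ ∘ r) (λ e → u e * + q) v) ⟨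
      div s t (λ e → + r e + u e * + q) v - div s t u v * + q
        ≡⟨ cong (_- div s t u v * + q) (div-cong (λ e → a≡a%ℕn+[a/ℕn]*n (ψ e) q) v) ⟨
      div s t ψ v - div s t u v * + q
        ≡⟨ cong (_- div s t u v * + q) (_∣_.equality (q∣div v)) ⟩
      quotient (q∣div v) * + q - div s t u v * + q
        ≡⟨ factor (quotient (q∣div v)) (div s t u v) (+ q) ⟩
      d v * + q ∎
      where
      drop-+ : ∀ x y → x ≡ x + y - y
      drop-+ = solve-∀
      factor : ∀ x y z → x * z - y * z ≡ (x - y) * z
      factor = solve-∀

    total-d*q : ∀ χ → total χ d * + q ≡ sum (λ e → + r e * (𝟙 (χ (s e)) - 𝟙 (χ (t e))))
    total-d*q χ = begin-equality
      total χ d * + q               ≡⟨ total-* χ d (+ q) ⟨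
      total χ (λ v → d v * + q)     ≡⟨ total-cong χ div-r ⟨
      total χ (div s t (+_ ∘ r))    ≡⟨ total-div χ (+_ ∘ r) ⟩
      sum (λ e → + r e * (𝟙 (χ (s e)) - 𝟙 (χ (t e)))) ∎

    d-total : total (const true) d ≡ 0ℤ
    d-total = *-cancelʳ-≡ _ 0ℤ (+ q) (begin-equality
      total (const true) d * + q   ≡⟨ total-d*q (const true) ⟩
      sum (λ e → + r e * 0ℤ)       ≡⟨ *-distribʳ-sum 0ℤ (+_ ∘ r) ⟨
      sum (+_ ∘ r) * 0ℤ            ≡⟨ *-zeroʳ (sum (+_ ∘ r)) ⟩
      0ℤ * + q                     ∎)

    cut : ∀ χ → total χ d ≤ capacity s t cap χ
    cut χ = *-cancelʳ-≤-pos _ _ (+ q) (begin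
      total χ d * + q
        ≡⟨ total-d*q χ ⟩
      sum (λ e → + r e * (𝟙 (χ (s e)) - 𝟙 (χ (t e))))
        ≤⟨ sum-mono-≤ (λ e → residue≤leaving (χ (s e)) (χ (t e)) (ℕ.<⇒≤ (n%ℕd<d (ψ e) q))) ⟩
      sum (λ e → leaving (cap e) (χ (s e)) (χ (t e)) * + q)
        ≡⟨ *-distribʳ-sum (+ q) (λ e → leaving (cap e) (χ (s e)) (χ (t e))) ⟨
      capacity s t cap χ * + q ∎)

    routing : ∃[ x ] (∀ e → x e ≡ true → cap e ≡ true) × (∀ v → d v ≡ div s t (𝟙 ∘ x) v)
    routing = satisfy-demand s t cap d d-total cut
    x : Fin k → Bool
    x = proj₁ routing
    τ : Fin k → ℤ
    τ e = - u e - 𝟙 (x e)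

    τ∈ : ∀ e → τ e ∈ roundings q (ψ e)
    τ∈ e = ∈-roundings q (ψ e) (x e) (proj₁ (proj₂ routing) e)

    circ : Circulation (λ e → ψ e + τ e * + q)
    circ v = begin-equality
      div s t (λ e → ψ e + τ e * + q) v
        ≡⟨ div-cong (λ e → trans (cong (_+ τ e * + q) (a≡a%ℕn+[a/ℕn]*n (ψ e) q))
                                 (cancel-u (+ r e) (u e) (𝟙 (x e)) (+ q))) v ⟩
      div s t (λ e → + r e + 𝟙 (x e) * (- + q)) v
        ≡⟨ div-+ (+_ ∘ r) (λ e → 𝟙 (x e) * (- + q)) v ⟩
      div s t (+_ ∘ r) v + div s t (λ e → 𝟙 (x e) * (- + q)) v
        ≡⟨ cong₂ _+_ (div-r v) (div-* (𝟙 ∘ x) (- + q) v) ⟩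
      d v * + q + div s t (𝟙 ∘ x) v * (- + q)
        ≡⟨ cong (λ y → d v * + q + y * (- + q)) (proj₂ (proj₂ routing) v) ⟨
      d v * + q + d v * (- + q)
        ≡⟨ opposite (d v) (+ q) ⟩
      0ℤ ∎
      where
      cancel-u : ∀ r u x q → r + u * q + (- u - x) * q ≡ r + x * (- q)
      cancel-u = solve-∀
      opposite : ∀ x y → x * y + x * (- y) ≡ 0ℤ
      opposite = solve-∀

  circulation-+ : ∀ φ ψ → Circulation φ → Circulation ψ → Circulation (λ e → φ e + ψ e)
  circulation-+ φ ψ φ-circ ψ-circ v = trans (div-+ φ ψ v) (cong₂ _+_ (φ-circ v) (ψ-circ v))

  circulation-neg : ∀ φ → Circulation φ → Circulation (λ e → - φ e)
  circulation-neg φ φ-circ v = begin-equality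
    div s t (λ e → - φ e) v       ≡⟨ div-cong (λ e → trans (sym (-1*i≡-i (φ e))) (*-comm -1ℤ (φ e))) v ⟩
    div s t (λ e → φ e * -1ℤ) v   ≡⟨ div-* φ -1ℤ v ⟩
    div s t φ v * -1ℤ             ≡⟨ cong (_* -1ℤ) (φ-circ v) ⟩
    0ℤ                            ∎
    where open ≤-Reasoning

  circulation-∣ : ∀ q φ → Circulation φ → ∀ v → q ∣ div s t φ v
  circulation-∣ q φ φ-circ v = divides 0ℤ (φ-circ v)

  module _ {q} .{{_ : ℕ.NonZero q}} {ψ} (R : Rounding q ψ) where
    open Rounding R

    div-rounded : ∀ v → div s t ψ v + div s t quotients v * + q ≡ 0ℤ
    div-rounded v = trans
      (sym (trans (div-+ ψ (λ e → quotients e * + q) v)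
                  (cong (λ x → div s t ψ v + x) (div-* quotients (+ q) v))))
      (circulation v)

  -- Both `ψ` and `rounded` are circulations, they differ by `q` times the quotients, and the
  -- integers have no torsion.
  quotients-circulation : ∀ {q} .{{_ : ℕ.NonZero q}} {ψ} (R : Rounding q ψ) →
                          Circulation ψ → Circulation (Rounding.quotients R)
  quotients-circulation {q@(ℕ.suc _)} {ψ} R ψ-circ v = *-cancelʳ-≡ _ 0ℤ (+ q) (begin-equality
    div s t quotients v * + q                 ≡⟨ +-identityˡ _ ⟨
    0ℤ + div s t quotients v * + q            ≡⟨ cong (_+ div s t quotients v * + q) (ψ-circ v) ⟨
    div s t ψ v + div s t quotients v * + q   ≡⟨ div-rounded R v ⟩
    0ℤ * + q                                  ∎)
    where
    open ≤-Reasoning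
    open Rounding R

  -- ψ + quotients = (ψ + rounded) / 2.
  half-div : ∀ {ψ} (R : Rounding 2 ψ) → (∀ v → + 4 ∣ div s t ψ v) →
             ∀ v → + 2 ∣ div s t (λ e → ψ e + Rounding.quotients R e) v
  half-div {ψ} R 4∣div v with divides a ψ≡ ← 4∣div v =
   divides a (*-cancelʳ-≡ _ _ (+ 2) (begin-equality
    div s t (λ e → ψ e + quotients e) v * + 2                    ≡⟨ cong (_* + 2) (div-+ ψ quotients v) ⟩
    -- After regrouping, the second summand is the divergence of the rounded chain, which is 0; only
    -- the multiple of 4 is left to halve.
    (div s t ψ v + div s t quotients v) * + 2                    ≡⟨ regroup (div s t ψ v) (div s t quotients v) ⟩
    div s t ψ v + (div s t ψ v + div s t quotients v * + 2)      ≡⟨ cong₂ _+_ ψ≡ (div-rounded R v) ⟩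
    a * + 4 + 0ℤ                                                 ≡⟨ +-identityʳ _ ⟩
    a * + 4                                                      ≡⟨ *-assoc a (+ 2) (+ 2) ⟨
    a * + 2 * + 2                                                ∎))
    where
    open ≤-Reasoning
    open Rounding R
    regroup : ∀ x y → (x + y) * + 2 ≡ x + (x + y * + 2)
    regroup = solve-∀

-- Flows as integer circulations, and congruences modulo `n`.

module _ (G : Graph) where
  open Graph G

  divergence-ℤ : ∀ φ v → outSum ℤ⁺ G φ v - inSum ℤ⁺ G φ v ≡ div src tgt φ v
  divergence-ℤ φ v = begin-equality
    outSum ℤ⁺ G φ v - inSum ℤ⁺ G φ v  ≡⟨ cong₂ _-_ (at src) (at tgt) ⟩
    sum out - sum in′                 ≡⟨ cong (_- sum in′) (trans (sum-cong-≗ split) (∑-distrib-+ net in′)) ⟩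
    sum net + sum in′ - sum in′       ≡⟨ +-assoc (sum net) (sum in′) _ ⟩
    sum net + (sum in′ - sum in′)     ≡⟨ cong (λ x → sum net + x) (+-inverseʳ (sum in′)) ⟩
    sum net + 0ℤ                      ≡⟨ +-identityʳ _ ⟩
    sum net                           ∎
    where
    open ≤-Reasoning
    out in′ net : E → ℤ
    out e = φ e * 𝟙 (does (src e ≟ v))
    in′ e = φ e * 𝟙 (does (tgt e ≟ v))
    net e = φ e * ∂ (src e) (tgt e) v
    at : ∀ end → sum (λ e → if does (end e ≟ v) then φ e else 0ℤ) ≡
                 sum (λ e → φ e * 𝟙 (does (end e ≟ v)))
    at end = sum-cong-≗ λ e → if≡*𝟙 (does (end e ≟ v)) (φ e)
    split : ∀ e → out e ≡ net e + in′ e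
    split e = lemma (φ e) (𝟙 (does (src e ≟ v))) (𝟙 (does (tgt e ≟ v)))
      where
      lemma : ∀ x y z → x * y ≡ x * (y - z) + x * z
      lemma = solve-∀

  circulation⇒flow : ∀ φ → Circulation src tgt φ → IsFlow ℤ⁺ G φ
  circulation⇒flow φ circ v = trans (divergence-ℤ φ v) (circ v)

module _ (n : ℕ) .{{_ : ℕ.NonZero n}} where
  private module ℤ/n = AbelianGroup (ℤ/ n)

  infix 4 _≡[mod]_
  -- It relates residues to integers, as `divergence-resp-~` requires for comparing a flow in `ℤ/ n`
  -- with its integer lift.
  _≡[mod]_ : Fin n → ℤ → Set
  a ≡[mod] i = ∃[ q ] i ≡ + toℕ a + q * + n

  -- Zero, sum and inverse in `ℤ/ n` are each a natural number reduced by `_mod n`, so this settles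
  -- all three.
  mod-≡[mod] : ∀ {i} m q → i ≡ + m + q * + n → (m mod n) ≡[mod] i
  mod-≡[mod] {i} m q i≡ = + (m / n) + q , (begin-equality
    i                                        ≡⟨ i≡ ⟩
    + m + q * + n                            ≡⟨ cong (λ j → + j + q * + n) (m≡m%n+[m/n]*n m n) ⟩
    + (m % n) + + (m / n ℕ.* n) + q * + n
      ≡⟨ cong₂ (λ j x → + j + x + q * + n) (sym (toℕ-fromℕ< (m%n<n m n))) (pos-* (m / n) n) ⟩
    + toℕ (m mod n) + + (m / n) * + n + q * + n
      ≡⟨ factor (+ toℕ (m mod n)) (+ (m / n)) q (+ n) ⟩
    + toℕ (m mod n) + (+ (m / n) + q) * + n  ∎)
    where
    open ≤-Reasoning
    factor : ∀ a x y z → a + x * z + y * z ≡ a + (x + y) * z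
    factor = solve-∀

  ε-≡[mod] : ℤ/n.ε ≡[mod] 0ℤ
  ε-≡[mod] = mod-≡[mod] 0 0ℤ refl

  ∙-≡[mod] : ∀ {a b i j} → a ≡[mod] i → b ≡[mod] j → a ℤ/n.∙ b ≡[mod] i + j
  ∙-≡[mod] {a} {b} (p , refl) (q , refl) =
    mod-≡[mod] (toℕ a ℕ.+ toℕ b) (p + q) (regroup (+ toℕ a) (+ toℕ b) p q (+ n))
    where
    regroup : ∀ a b p q n → (a + p * n) + (b + q * n) ≡ (a + b) + (p + q) * n
    regroup = solve-∀

  ⁻¹-≡[mod] : ∀ {a i} → a ≡[mod] i → a ℤ/n.⁻¹ ≡[mod] - i
  -- The representative `n - a` borrows one `n`, whence the `- 1ℤ`.
  ⁻¹-≡[mod] {a} (p , refl) = mod-≡[mod] (n ℕ.∸ toℕ a) (- p - 1ℤ) (begin-equality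
    - (+ toℕ a + p * + n)                  ≡⟨ regroup (+ toℕ a) p (+ n) ⟩
    + n - + toℕ a + (- p - 1ℤ) * + n
      ≡⟨ cong (_+ (- p - 1ℤ) * + n) (trans (m-n≡m⊖n n (toℕ a)) (⊖-≥ (toℕ≤n a))) ⟩
    + (n ℕ.∸ toℕ a) + (- p - 1ℤ) * + n     ∎)
    where
    open ≤-Reasoning
    regroup : ∀ a p n → - (a + p * n) ≡ n - a + (- p - 1ℤ) * n
    regroup = solve-∀

  ∣-divergence : ∀ G (φ : Graph.E G → Fin n) → IsFlow (ℤ/ n) G φ →
                 ∀ v → + n ∣ div (Graph.src G) (Graph.tgt G) (+_ ∘ toℕ ∘ φ) v
  ∣-divergence G φ flow v = subst (+ n ∣_) (divergence-ℤ G ψ v)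
    (≡[mod]ε⇒∣ (subst (_≡[mod] (outSum ℤ⁺ G ψ v - inSum ℤ⁺ G ψ v)) (flow v)
      (divergence-resp-~ (ℤ/ n) ℤ⁺ _≡[mod]_ ε-≡[mod] ∙-≡[mod] ⁻¹-≡[mod] G φ ψ
        (λ e → 0ℤ , sym (+-identityʳ _)) v)))
    where
    ψ : Graph.E G → ℤ
    ψ = +_ ∘ toℕ ∘ φ
    ≡[mod]ε⇒∣ : ∀ {i} → ℤ/n.ε ≡[mod] i → + n ∣ i
    -- For a variable `n`, `toℕ ε` does not compute to 0; it is cancelled against the congruence of
    -- `ε` with 0.
    ≡[mod]ε⇒∣ {i} (p , i≡) with q , 0≡ ← ε-≡[mod] = divides (p - q) (begin-equality
      i                                                  ≡⟨ +-identityʳ i ⟨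
      i - 0ℤ                                             ≡⟨ cong₂ _-_ i≡ 0≡ ⟩
      (+ toℕ ℤ/n.ε + p * + n) - (+ toℕ ℤ/n.ε + q * + n)  ≡⟨ regroup (+ toℕ ℤ/n.ε) p q (+ n) ⟩
      (p - q) * + n                                      ∎)
      where
      open ≤-Reasoning
      regroup : ∀ a p q n → (a + p * n) - (a + q * n) ≡ (p - q) * n
      regroup = solve-∀

-- Arc coefficients and their finite verification.

module _ {c ℓ} (M : AbelianGroup c ℓ) {n} (g : Fin n → AbelianGroup.Carrier M) where
  open AbelianGroup M using (_≈_; _∙_)

  arc? : Decidable _≈_ → ∀ x c → Dec (Arc M g x c)
  arc? _≈?_ x c = Fin.any? λ a → Fin.any? λ b →
    ((g a ∙ x) ≈? g b) ×-dec Fin.all? λ i → c i ℤ.≟ (δ b i - δ a i)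

coeffs₂ : ℤ → Fin 2 → ℤ
coeffs₂ f 0F = - f
coeffs₂ f 1F = f

-- c₁ = d, c₁ + 2 c₂ = d - 2 s (the rounding of φ mod 3) and c₀ + c₁ + c₂ = 0.
coeffs₃ : ℤ → ℤ → Fin 3 → ℤ
coeffs₃ d s 0F = s - d
coeffs₃ d s 1F = d
coeffs₃ d s 2F = - s

-- Indices are pairs of bits, low bit first.  The coefficients sum to 0, and their sums against the
-- signs (-1)^b₀, (-1)^b₁ and (-1)^(b₀+b₁) are 2f, 2g and 2(f + g + 2s).
coeffs₄ : ℤ → ℤ → ℤ → Fin 4 → ℤ
coeffs₄ f g s 0F = f + g + s
coeffs₄ f g s 1F = - f - s
coeffs₄ f g s 2F = - g - s
coeffs₄ f g s 3F = s

arcs-ℤ/2 : ∀ x → All (λ t → Arc (ℤ/ 2) id x (coeffs₂ (+ toℕ x + t * + 2))) (roundings 2 (+ toℕ x))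
arcs-ℤ/2 = from-yes (Fin.all? λ x → all? (λ t →
  arc? (ℤ/ 2) id _≟_ x (coeffs₂ (+ toℕ x + t * + 2))) (roundings 2 (+ toℕ x)))

-- For `x = 1`, `f = -2` gives the arc from 2 to 0, while `f = 1` gives the arc from 0 to 1 if
-- `d = 1` and from 1 to 2 if `d = -1`. For `x = 2` these are reversed.
arcs-ℤ/3 : ∀ x → All (λ t → let f = + toℕ x + t * + 3 in
  All (λ s → Arc (ℤ/ 3) id x (coeffs₃ (f + s * + 2) s)) (roundings 2 f)) (roundings 3 (+ toℕ x))
arcs-ℤ/3 = from-yes (Fin.all? λ x → all? (λ t → let f = + toℕ x + t * + 3 in
  all? (λ s → arc? (ℤ/ 3) id _≟_ x (coeffs₃ (f + s * + 2) s)) (roundings 2 f)) (roundings 3 (+ toℕ x)))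

-- Since `u = x + 2 t`, the chain `x + t` is `(x + u) / 2`, and `w` is its rounding. Rounding
-- `u + w` supplies the third sign sum of `coeffs₄`, up to a factor 2.
arcs-ℤ/4 : ∀ x → All (λ t → let u = + toℕ x + t * + 2 in
  All (λ p → let w = + toℕ x + t + p * + 2 in
  All (λ s → Arc (ℤ/ 4) id x (coeffs₄ u w s))
    (roundings 2 (u + w))) (roundings 2 (+ toℕ x + t))) (roundings 2 (+ toℕ x))
arcs-ℤ/4 = from-yes (Fin.all? λ x → all? (λ t → let u = + toℕ x + t * + 2 in
  all? (λ p → let w = + toℕ x + t + p * + 2 in
  all? (λ s → arc? (ℤ/ 4) id _≟_ x (coeffs₄ u w s))
    (roundings 2 (u + w))) (roundings 2 (+ toℕ x + t))) (roundings 2 (+ toℕ x)))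

ℤ/2² : AbelianGroup 0ℓ 0ℓ
ℤ/2² = abelianGroup (ℤ/ 2) (ℤ/ 2)

bits : Fin 4 → Fin 2 × Fin 2
bits 0F = 0F , 0F
bits 1F = 1F , 0F
bits 2F = 0F , 1F
bits 3F = 1F , 1F

-- For nonzero `(x , y)` exactly two of `f`, `w` and `f + w + 2 s` are nonzero, each 1 or -1; the
-- four sign choices are the four arcs.
arcs-ℤ/2² : ∀ x y → All (λ t → let f = + toℕ x + t * + 2 in
  All (λ p → let w = + toℕ y + p * + 2 in
  All (λ s → Arc ℤ/2² bits (x , y) (coeffs₄ f w s))
    (roundings 2 (f + w))) (roundings 2 (+ toℕ y))) (roundings 2 (+ toℕ x))
arcs-ℤ/2² = from-yes (Fin.all? λ x → Fin.all? λ y → all? (λ t → let f = + toℕ x + t * + 2 in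
  all? (λ p → let w = + toℕ y + p * + 2 in
  all? (λ s → arc? ℤ/2² bits (λ (a , b) (a′ , b′) → (a ≟ a′) ×-dec (b ≟ b′)) (x , y) (coeffs₄ f w s))
    (roundings 2 (f + w))) (roundings 2 (+ toℕ y))) (roundings 2 (+ toℕ x)))

-- Arc flows for the four groups.

module _ (G : Graph) where
  open Graph G
  open Rounding

  private
    Circ : (E → ℤ) → Set
    Circ = Circulation src tgt

  arcFlow-ℤ/2 : ∀ φ → IsFlow (ℤ/ 2) G φ → ArcFlow (ℤ/ 2) id G φ
  arcFlow-ℤ/2 φ flow =
      (λ i e → coeffs₂ (f e) i)
    , (λ i → circulation⇒flow G (λ e → coeffs₂ (f e) i) (at i))
    , (λ e → All.lookup (arcs-ℤ/2 (φ e)) (∈roundings F e))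
    where
    F = round src tgt 2 (+_ ∘ toℕ ∘ φ) (∣-divergence 2 G φ flow)
    f = rounded F
    at : ∀ i → Circ (λ e → coeffs₂ (f e) i)
    at 0F = circulation-neg src tgt f (circulation F)
    at 1F = circulation F

  arcFlow-ℤ/3 : ∀ φ → IsFlow (ℤ/ 3) G φ → ArcFlow (ℤ/ 3) id G φ
  arcFlow-ℤ/3 φ flow =
      (λ i e → coeffs₃ (d e) (s e) i)
    , (λ i → circulation⇒flow G (λ e → coeffs₃ (d e) (s e) i) (at i))
    , (λ e → All.lookup (All.lookup (arcs-ℤ/3 (φ e)) (∈roundings F e)) (∈roundings D e))
    where
    F = round src tgt 3 (+_ ∘ toℕ ∘ φ) (∣-divergence 3 G φ flow)
    f = rounded F
    -- Any modulus divides the zero divergence of a circulation, so `f` can be rounded again.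
    D = round src tgt 2 f (circulation-∣ src tgt (+ 2) f (circulation F))
    d = rounded D
    s = quotients D
    s-circ : Circ s
    s-circ = quotients-circulation src tgt D (circulation F)
    at : ∀ i → Circ (λ e → coeffs₃ (d e) (s e) i)
    at 0F = circulation-+ src tgt s (λ e → - d e) s-circ (circulation-neg src tgt d (circulation D))
    at 1F = circulation D
    at 2F = circulation-neg src tgt s s-circ

  module _ (f g : E → ℤ) (f-circ : Circ f) (g-circ : Circ g) where

    f+g-circ : Circ (λ e → f e + g e)
    f+g-circ = circulation-+ src tgt f g f-circ g-circ

    -- Common to both groups of order 4. The sum is a circulation already; rounding brings its
    -- values down to -1, 0 and 1, and the quotients become the last coefficient.
    parity : Rounding src tgt 2 (λ e → f e + g e)
    parity = round src tgt 2 (λ e → f e + g e) (circulation-∣ src tgt (+ 2) (λ e → f e + g e) f+g-circ)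

    coeffs₄-flow : ∀ i → IsFlow ℤ⁺ G (λ e → coeffs₄ (f e) (g e) (quotients parity e) i)
    coeffs₄-flow i = circulation⇒flow G (λ e → coeffs₄ (f e) (g e) (s e) i) (at i)
      where
      s = quotients parity
      s-circ : Circ s
      s-circ = quotients-circulation src tgt parity f+g-circ
      -s-circ : Circ (λ e → - s e)
      -s-circ = circulation-neg src tgt s s-circ
      at : ∀ i → Circ (λ e → coeffs₄ (f e) (g e) (s e) i)
      at 0F = circulation-+ src tgt (λ e → f e + g e) s f+g-circ s-circ
      at 1F = circulation-+ src tgt (λ e → - f e) (λ e → - s e) (circulation-neg src tgt f f-circ) -s-circ
      at 2F = circulation-+ src tgt (λ e → - g e) (λ e → - s e) (circulation-neg src tgt g g-circ) -s-circ
      at 3F = s-circ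

  arcFlow-ℤ/2² : ∀ φ → IsFlow ℤ/2² G φ → ArcFlow ℤ/2² bits G φ
  arcFlow-ℤ/2² φ flow =
      (λ i e → coeffs₄ (f e) (g e) (quotients S e) i)
    , coeffs₄-flow f g (circulation F₁) (circulation F₂)
    , (λ e → All.lookup (All.lookup (All.lookup (arcs-ℤ/2² (proj₁ (φ e)) (proj₂ (φ e)))
                (∈roundings F₁ e)) (∈roundings F₂ e)) (∈roundings S e))
    where
    F₁ = round src tgt 2 (+_ ∘ toℕ ∘ proj₁ ∘ φ)
           (∣-divergence 2 G (proj₁ ∘ φ) (flow-homo ℤ/2² (ℤ/ 2) proj₁ proj₁ (λ _ _ → refl) G φ flow))
    F₂ = round src tgt 2 (+_ ∘ toℕ ∘ proj₂ ∘ φ)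
           (∣-divergence 2 G (proj₂ ∘ φ) (flow-homo ℤ/2² (ℤ/ 2) proj₂ proj₂ (λ _ _ → refl) G φ flow))
    f = rounded F₁
    g = rounded F₂
    S = parity f g (circulation F₁) (circulation F₂)

  arcFlow-ℤ/4 : ∀ φ → IsFlow (ℤ/ 4) G φ → ArcFlow (ℤ/ 4) id G φ
  arcFlow-ℤ/4 φ flow =
      (λ i e → coeffs₄ (u e) (p e) (quotients S e) i)
    , coeffs₄-flow u p (circulation U) (circulation P)
    , (λ e → All.lookup (All.lookup (All.lookup (arcs-ℤ/4 (φ e))
                (∈roundings U e)) (∈roundings P e)) (∈roundings S e))
    where
    ψ : E → ℤ
    ψ e = + toℕ (φ e)
    4∣div : ∀ v → + 4 ∣ div src tgt ψ v
    4∣div = ∣-divergence 4 G φ flow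
    U = round src tgt 2 ψ λ v → ∣-trans (divides (+ 2) refl) (4∣div v)
    -- The chain rounded here is `(ψ + u) / 2`; full divisibility by 4, not just by 2, makes its
    -- divergence even.
    P = round src tgt 2 (λ e → ψ e + quotients U e) (half-div src tgt U 4∣div)
    u = rounded U
    p = rounded P
    S = parity u p (circulation U) (circulation P)

theorem14 : ∀ c′ ℓ′ (M : AbelianGroup 0ℓ 0ℓ) →
    M ≡ ℤ/ 2 ⊎ M ≡ ℤ/ 3 ⊎ M ≡ abelianGroup (ℤ/ 2) (ℤ/ 2) ⊎ M ≡ ℤ/ 4 →
    (G : Graph) → StrongHomomorphismProperty c′ ℓ′ G M
theorem14 c′ ℓ′ _ (inj₁ refl) G =
  arcFlows⇒strongHomomorphism (ℤ/ 2) id G (arcFlow-ℤ/2 G)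
theorem14 c′ ℓ′ _ (inj₂ (inj₁ refl)) G =
  arcFlows⇒strongHomomorphism (ℤ/ 3) id G (arcFlow-ℤ/3 G)
theorem14 c′ ℓ′ _ (inj₂ (inj₂ (inj₁ refl))) G =
  arcFlows⇒strongHomomorphism ℤ/2² bits G (arcFlow-ℤ/2² G)
theorem14 c′ ℓ′ _ (inj₂ (inj₂ (inj₂ refl))) G =
  arcFlows⇒strongHomomorphism (ℤ/ 4) id G (arcFlow-ℤ/4 G)
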